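{- The cycle index of the $4$-group $S_9^{(4)}$ of the symmetric group $S_9$, i.e. of the action of $S_9$ on the $126$ four-element subsets of $\{1,\dots,9\}$, in the variables $a_1,a_2,\dots$, is \begin{align*} Z(S_9^{(4)}) = \frac{1}{9!} \big(& a_{1}^{126} + 36 a_{1}^{56} a_{2}^{35} + 378 a_{1}^{26} a_{2}^{50} + 168 a_{1}^{21} a_{3}^{35} + 1260 a_{1}^{12} a_{2}^{57} \\ & + 2520 a_{1}^{11} a_{2}^{5} a_{3}^{15} a_{6}^{10} + 945 a_{1}^{6} a_{2}^{60} + 756 a_{1}^{6} a_{2}^{10} a_{4}^{25} + 3360 a_{1}^{6} a_{3}^{40} \\ & + 7560 a_{1}^{5} a_{2}^{8} a_{3}^{7} a_{6}^{14} + 7560 a_{1}^{4} a_{2}^{11} a_{4}^{25} + 15120 a_{1}^{3} a_{2} a_{3} a_{4}^{4} a_{6}^{3} a_{12}^{7} \\ & + 2520 a_{1}^{3} a_{2}^{9} a_{3}^{3} a_{6}^{16} + 11340 a_{1}^{2} a_{2}^{12} a_{4}^{25} + 10080 a_{1}^{2} a_{2}^{2} a_{3}^{18} a_{6}^{11} \\ & + 11340 a_{1}^{2} a_{2}^{2} a_{4}^{30} + 9072 a_{1} a_{5}^{5} a_{10}^{10} + 18144 a_{1} a_{5}^{11} a_{10}^{7} \\ & + 18144 a_{1} a_{5} a_{10}^{2} a_{20}^{5} + 15120 a_{1} a_{2}^{2} a_{3} a_{4}^{4} a_{6}^{3} a_{12}^{7} + 24192 a_{1} a_{5}^{4} a_{15}^{7}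 \\ & + 3024 a_{1} a_{5}^{25} + 25920 a_{7}^{8} a_{14}^{5} + 10080 a_{2}^{3} a_{3}^{4} a_{6}^{18} + 30240 a_{2}^{3} a_{3}^{2} a_{6}^{19} \\ & + 45360 a_{2} a_{4} a_{8}^{15} + 2240 a_{3}^{42} + 20160 a_{3}^{4} a_{6}^{19} + 25920 a_{7}^{18} + 40320 a_{9}^{14}\big). \end{align*}
   Context: For a permutation group $A$ on a finite set, and $\alpha\in A$, let $j_k(\alpha)$ be the number of cycles of length $k$ in the disjoint cycle decomposition of $\alpha$ (fixed points counted as cycles of length $1$). The cycle index of $A$ is the polynomial $Z(A)=\frac{1}{|A|}\sum_{\alpha\in A}\prod_{k} a_k^{j_k(\alpha)}$ in the variables $a_1,a_2,\dots$ with rational coefficients. For $1\le r\le p$, $S_p^{(r)}$ (the $r$-group of $S_p$) is the permutation group on the set of $r$-element subsets of $\{1,\dots,p\}$ formed by the permutations $\alpha'$ induced by $\alpha\in S_p$ via $\alpha'\{i_1,\dots,i_r\}=\{\alpha i_1,\dots,\alpha i_r\}$. -}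

module Defs where

import Algebra.Properties.CommutativeMonoid.Sum as Sum
open import Data.Bool.Base using (Bool; true; false; if_then_else_)
open import Data.Bool.Properties using () renaming (_≟_ to _≟ᵇ_)
open import Data.Fin.Base using (Fin; zero; suc; punchIn)
open import Data.Fin.Properties using (punchIn-injective) renaming (_≟_ to _≟ᶠ_)
open import Data.Fin.Permutation as Perm using (Permutation′; _⟨$⟩ʳ_; _⟨$⟩ˡ_; insert; remove)
open import Data.Fin.Subset using (Subset; inside; outside; ∣_∣) renaming (_∈_ to _∈ˢ_)
open import Data.Integer.Base using (+_)
open import Data.Irrelevant using ([_])
open import Data.List.Base
  using (List; []; _∷_; _++_; map; filter; length; allFin; iterate; takeWhile; deduplicate; applyUpTo; cartesianProductWith)
open import Data.List.Membership.Propositional using (_∈_; _∉_)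
open import Data.List.Membership.Propositional.Properties using (∈-allFin; ∈-++⁺ˡ; ∈-++⁺ʳ; ∈-map⁺; ∈-map⁻)
open import Data.List.Properties using (filter-none)
import Data.List.Membership.DecPropositional as DecMembership
import Data.List.Membership.Setoid as Membership
import Data.List.Membership.Setoid.Properties as Membershipₚ
open import Data.List.Relation.Unary.All as All using (All; []; _∷_)
open import Data.List.Relation.Unary.AllPairs using ([]; _∷_)
open import Data.List.Relation.Unary.Any using (here; there)
open import Data.List.Relation.Unary.Unique.Propositional using (Unique)
import Data.List.Relation.Unary.Unique.Propositional.Properties as Uniqueₚ
import Data.List.Relation.Unary.Unique.Setoid as UniqueS
import Data.List.Relation.Unary.Unique.Setoid.Properties as UniqueSₚ
import Data.List.Relation.Unary.Unique.DecSetoid.Properties as UniqueDSₚ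
open import Data.Nat.Base using (ℕ; zero; suc; NonZero)
open import Data.Nat.ListAction using (sum)
import Data.Nat.Properties as ℕₚ
open import Data.Product.Base using (∃-syntax; _×_; _,_; proj₁; proj₂)
open import Data.Rational.Base as ℚ using (ℚ; 0ℚ; 1ℚ)
open import Data.Refinement as Refinement using (Refinement; _,_; value)
open import Data.Vec.Base using (_∷_; []; lookup; tabulate)
import Data.Vec.Properties as Vecₚ
open import Function.Base using (_∘_)
open import Function.Bundles using (_↔_; _⇔_; Inverse; mk↔ₛ′; mk⇔)
open import Function.Construct.Composition using (_↔-∘_)
open import Function.Construct.Identity using (↔-id)
open import Function.Construct.Symmetry using (↔-sym)
open import Level using (0ℓ)
open import Relation.Binary.Bundles using (Setoid; DecSetoid)
open import Relation.Binary.Definitions using (DecidableEquality; Decidable)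
open import Relation.Binary.PropositionalEquality
  using (_≡_; refl; sym; trans; cong; setoid; module ≡-Reasoning)
open import Relation.Nullary.Decidable using (yes; no; does; ¬?; map′)
open import Relation.Nullary.Negation using (contradiction)

------------------------------------------------------------------------
-- Polynomials with rational coefficients in the variables a₁, a₂, …

-- A formal product of powers a_k^e, stored as the pairs (k , e); a variable
-- may occur several times, so monomials are compared by their exponents.
Monomial : Set
Monomial = List (ℕ × ℕ)

exponent : ℕ → Monomial → ℕ
exponent k m = sum (map proj₂ (filter (λ f → proj₁ f ℕₚ.≟ k) m))

infix 4 _≈ᵐ_ _≈ᵐ?_

_≈ᵐ_ : Monomial → Monomial → Set
m ≈ᵐ m′ = ∀ k → exponent k m ≡ exponent k m′

private
  exponent-absent : ∀ k m → (∀ {e} → (k , e) ∉ m) → exponent k m ≡ 0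
  exponent-absent k m absent = cong (sum ∘ map proj₂)
    (filter-none (λ f → proj₁ f ℕₚ.≟ k) (All.tabulate λ { p refl → absent p }))

_≈ᵐ?_ : Decidable _≈ᵐ_
m ≈ᵐ? m′ = map′ everywhere (λ eq → All.tabulate (λ {k} _ → eq k))
  (All.all? (λ k → exponent k m ℕₚ.≟ exponent k m′) keys)
  where
  keys : List ℕ
  keys = map proj₁ (m ++ m′)

  everywhere : All (λ k → exponent k m ≡ exponent k m′) keys → m ≈ᵐ m′
  everywhere eqs k with DecMembership._∈?_ ℕₚ._≟_ k keys
  ... | yes k∈ = All.lookup eqs k∈
  ... | no  k∉ = trans
    (exponent-absent k m (λ p → k∉ (∈-map⁺ proj₁ (∈-++⁺ˡ p))))
    (sym (exponent-absent k m′ (λ p → k∉ (∈-map⁺ proj₁ (∈-++⁺ʳ m p)))))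

-- A formal sum of terms q · m; like monomials may occur several times, and
-- polynomials are compared by their coefficients.
Polynomial : Set
Polynomial = List (ℚ × Monomial)

coefficient : Polynomial → Monomial → ℚ
coefficient []             m = 0ℚ
coefficient ((q , m′) ∷ f) m =
  if does (m′ ≈ᵐ? m) then q ℚ.+ coefficient f m else coefficient f m

infix 4 _≈ᵖ_

_≈ᵖ_ : Polynomial → Polynomial → Set
f ≈ᵖ g = ∀ m → coefficient f m ≡ coefficient g m

infix  9 a[_]^_
infixr 8 _·_
infix  7 _∙_
infixr 6 _⊕_
infixr 5 _⊛_

a[_]^_ : ℕ → ℕ → Monomial
a[ k ]^ e = (k , e) ∷ []

_·_ : Monomial → Monomial → Monomial
_·_ = _++_

_∙_ : ℕ → Monomial → Polynomial
n ∙ m = (+ n ℚ./ 1 , m) ∷ []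

_⊕_ : Polynomial → Polynomial → Polynomial
_⊕_ = _++_

_⊛_ : ℚ → Polynomial → Polynomial
q ⊛ f = map (λ t → q ℚ.* proj₁ t , proj₂ t) f

------------------------------------------------------------------------
-- Permutation groups on finite sets

record FiniteSet : Set₁ where
  infix 4 _≟_
  field
    Carrier  : Set
    _≟_      : DecidableEquality Carrier
    elements : List Carrier
    complete : ∀ x → x ∈ elements
    unique   : Unique elements

  size : ℕ
  size = length elements

module _ (X : FiniteSet) where
  open FiniteSet X

  Permutation : Set
  Permutation = Carrier ↔ Carrier

  permDecSetoid : DecSetoid 0ℓ 0ℓ
  permDecSetoid = record
    { Carrier = Permutation
    ; _≈_ = λ σ τ → ∀ x → Inverse.to σ x ≡ Inverse.to τ x
    ; isDecEquivalence = record
      { isEquivalence = record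
        { refl  = λ _ → refl
        ; sym   = λ p x → sym (p x)
        ; trans = λ p q x → trans (p x) (q x)
        }
      ; _≟_ = λ σ τ → map′ (λ eqs x → All.lookup eqs (complete x)) (λ p → All.tabulate (λ {x} _ → p x))
          (All.all? (λ x → Inverse.to σ x ≟ Inverse.to τ x) elements)
      }
    }

  permSetoid : Setoid 0ℓ 0ℓ
  permSetoid = DecSetoid.setoid permDecSetoid

record PermutationGroup (X : FiniteSet) : Set where
  open Membership (permSetoid X) using () renaming (_∈_ to _∈ₚ_)
  field
    elements  : List (Permutation X)
    unique    : UniqueS.Unique (permSetoid X) elements
    id-closed : ↔-id _ ∈ₚ elements
    ∘-closed  : ∀ {σ τ} → σ ∈ₚ elements → τ ∈ₚ elements → (σ ↔-∘ τ) ∈ₚ elements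
    ⁻¹-closed : ∀ {σ} → σ ∈ₚ elements → ↔-sym σ ∈ₚ elements

  order : ℕ
  order = length elements

  order-nonZero : NonZero order
  order-nonZero with elements | id-closed
  ... | _ ∷ _ | _ = _

------------------------------------------------------------------------
-- The cycle index

module _ {X : FiniteSet} where
  open FiniteSet X

  -- The cycle (x , α x , α² x , …) of α through x.  It closes up after at
  -- most size steps, so the bound on the number of iterates cuts nothing off.
  cycleThrough : Permutation X → Carrier → List Carrier
  cycleThrough α x = x ∷ takeWhile (λ y → ¬? (y ≟ x)) (iterate (Inverse.to α) (Inverse.to α x) size)

  -- The disjoint cycles of α: one for each class of the relation
  -- "y lies on the cycle through x".
  cycles : Permutation X → List (List Carrier)
  cycles α = map (cycleThrough α)
    (deduplicate (λ x y → DecMembership._∈?_ _≟_ y (cycleThrough α x)) elements)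

  j : ℕ → Permutation X → ℕ
  j k α = length (filter (λ c → length c ℕₚ.≟ k) (cycles α))

  -- No cycle is longer than size, so the product runs over k = 1, …, size.
  cycleMonomial : Permutation X → Monomial
  cycleMonomial α = map (λ k → k , j k α) (applyUpTo suc size)

  Z : PermutationGroup X → Polynomial
  Z A = (+ 1 ℚ./ A.order) ⊛ map (λ α → 1ℚ , cycleMonomial α) A.elements
    where
    module A = PermutationGroup A
    instance _ = A.order-nonZero

------------------------------------------------------------------------
-- The symmetric group of degree p

FinSet : ℕ → FiniteSet
FinSet p = record
  { Carrier  = Fin p
  ; _≟_      = _≟ᶠ_
  ; elements = allFin p
  ; complete = ∈-allFin
  ; unique   = Uniqueₚ.allFin⁺ p
  }

-- insert zero i π sends zero to i and acts on the remaining points as π.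
permutations : ∀ p → List (Permutation′ p)
permutations zero    = Perm.id ∷ []
permutations (suc p) = cartesianProductWith (insert zero) (allFin (suc p)) (permutations p)

private
  insert-zero : ∀ {p} i (π : Permutation′ p) k → insert zero i π ⟨$⟩ʳ suc k ≡ punchIn i (π ⟨$⟩ʳ k)
  insert-zero i π k = Perm.insert-punchIn zero i π k

  insert-cong : ∀ {p i i′} {π π′ : Permutation′ p} → i ≡ i′ → π Perm.≈ π′ →
                insert zero i π Perm.≈ insert zero i′ π′
  insert-cong refl eq zero    = refl
  insert-cong {i = i} {π = π} {π′} refl eq (suc k) =
    trans (insert-zero i π k) (trans (cong (punchIn i) (eq k)) (sym (insert-zero i π′ k)))

  insert-injective : ∀ {p i i′} {π π′ : Permutation′ p} →
                     insert zero i π Perm.≈ insert zero i′ π′ → i ≡ i′ × π Perm.≈ π′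
  insert-injective {i = i} {i′} {π} {π′} eq with eq zero
  ... | refl = refl , λ k → punchIn-injective i _ _
    (trans (sym (insert-zero i π k)) (trans (eq (suc k)) (insert-zero i π′ k)))

permutations-complete : ∀ {p} (π : Permutation′ p) → Membership._∈_ (permSetoid (FinSet p)) π (permutations p)
permutations-complete {zero}  π = here (λ ())
permutations-complete {suc p} π = Membershipₚ.∈-resp-≈ (permSetoid (FinSet (suc p)))
  {permutations (suc p)} {insert zero (π ⟨$⟩ʳ zero) (remove zero π)} {π} (Perm.insert-remove zero π)
  (Membershipₚ.∈-cartesianProductWith⁺ (setoid (Fin (suc p))) (permSetoid (FinSet p)) (permSetoid (FinSet (suc p)))
    {f = insert zero}
    (λ {i} {i′} {π} {π′} → insert-cong {i = i} {i′} {π} {π′})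
    (∈-allFin (π ⟨$⟩ʳ zero)) (permutations-complete (remove zero π)))

permutations-unique : ∀ p → UniqueS.Unique (permSetoid (FinSet p)) (permutations p)
permutations-unique zero    = [] ∷ []
permutations-unique (suc p) = UniqueSₚ.cartesianProductWith⁺
  (setoid (Fin (suc p))) (permSetoid (FinSet p)) (permSetoid (FinSet (suc p)))
  (insert zero) (λ {i} {i′} {π} {π′} → insert-injective {i = i} {i′} {π} {π′})
  (Uniqueₚ.allFin⁺ (suc p)) (permutations-unique p)

S : ∀ p → PermutationGroup (FinSet p)
S p = record
  { elements  = permutations p
  ; unique    = permutations-unique p
  ; id-closed = permutations-complete (↔-id _)
  ; ∘-closed  = λ {σ} {τ} _ _ → permutations-complete (σ ↔-∘ τ)
  ; ⁻¹-closed = λ {σ} _ → permutations-complete (↔-sym σ)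
  }

------------------------------------------------------------------------
-- The r-element subsets of Fin p

RSubset : ℕ → ℕ → Set
RSubset p r = Refinement (Subset p) (λ s → ∣ s ∣ ≡ r)

_≟ˢ_ : ∀ {p r} → DecidableEquality (RSubset p r)
_≟ˢ_ = Refinement._≟_ (Vecₚ.≡-dec _≟ᵇ_)

private
  with-point : ∀ {p r} → RSubset p r → RSubset (suc p) (suc r)
  with-point = Refinement.map (inside ∷_) (cong suc)

  without-point : ∀ {p r} → RSubset p r → RSubset (suc p) r
  without-point = Refinement.map (outside ∷_) (λ eq → eq)

rSubsets : ∀ p r → List (RSubset p r)
rSubsets zero    zero    = ([] , [ refl ]) ∷ []
rSubsets zero    (suc r) = []
rSubsets (suc p) zero    = map without-point (rSubsets p zero)
rSubsets (suc p) (suc r) = map with-point (rSubsets p r) ++ map without-point (rSubsets p (suc r))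

private
  value-injective : ∀ {p r} {s t : RSubset p r} → value s ≡ value t → s ≡ t
  value-injective = Refinement.value-injective

  with-injective : ∀ {p r} {s t : RSubset p r} → with-point s ≡ with-point t → s ≡ t
  with-injective = value-injective ∘ Vecₚ.∷-injectiveʳ ∘ cong value

  without-injective : ∀ {p r} {s t : RSubset p r} → without-point s ≡ without-point t → s ≡ t
  without-injective = value-injective ∘ Vecₚ.∷-injectiveʳ ∘ cong value

rSubsets-complete : ∀ {p r} (s : RSubset p r) → s ∈ rSubsets p r
rSubsets-complete {zero}  {zero}  ([] , _)           = here refl
rSubsets-complete {zero}  {suc r} ([] , [ () ])
rSubsets-complete {suc p} {zero}  (true ∷ s , [ () ])
rSubsets-complete {suc p} {zero}  (false ∷ s , [ eq ]) =
  ∈-map⁺ without-point (rSubsets-complete (s , [ eq ]))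
rSubsets-complete {suc p} {suc r} (true ∷ s , [ eq ])  =
  ∈-++⁺ˡ (∈-map⁺ with-point (rSubsets-complete (s , [ ℕₚ.suc-injective eq ])))
rSubsets-complete {suc p} {suc r} (false ∷ s , [ eq ]) =
  ∈-++⁺ʳ (map with-point (rSubsets p r)) (∈-map⁺ without-point (rSubsets-complete (s , [ eq ])))

rSubsets-unique : ∀ p r → Unique (rSubsets p r)
rSubsets-unique zero    zero    = [] ∷ []
rSubsets-unique zero    (suc r) = []
rSubsets-unique (suc p) zero    = Uniqueₚ.map⁺ without-injective (rSubsets-unique p zero)
rSubsets-unique (suc p) (suc r) = Uniqueₚ.++⁺
  (Uniqueₚ.map⁺ with-injective (rSubsets-unique p r))
  (Uniqueₚ.map⁺ without-injective (rSubsets-unique p (suc r)))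
  disjoint
  where
  disjoint : ∀ {s} → s ∈ map with-point (rSubsets p r) × s ∈ map without-point (rSubsets p (suc r)) → _
  disjoint (s∈₁ , s∈₂) with ∈-map⁻ with-point s∈₁ | ∈-map⁻ without-point s∈₂
  ... | _ , _ , eq₁ | _ , _ , eq₂ = contradiction (cong value (trans (sym eq₁) eq₂)) λ ()

RSubsetSet : ℕ → ℕ → FiniteSet
RSubsetSet p r = record
  { Carrier  = RSubset p r
  ; _≟_      = _≟ˢ_
  ; elements = rSubsets p r
  ; complete = rSubsets-complete
  ; unique   = rSubsets-unique p r
  }

------------------------------------------------------------------------
-- The permutation of r-subsets induced by a permutation of points

-- i ∈ image α s iff α⁻¹ i ∈ s; see ∈-image.
image : ∀ {p} → Permutation′ p → Subset p → Subset p
image α s = tabulate (λ i → lookup s (α ⟨$⟩ˡ i))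

∈-image : ∀ {p} (α : Permutation′ p) (s : Subset p) i → i ∈ˢ s ⇔ (α ⟨$⟩ʳ i) ∈ˢ image α s
∈-image α s i = mk⇔
  (λ i∈ → Vecₚ.lookup⇒[]= _ _ (trans lookup-image (Vecₚ.[]=⇒lookup i∈)))
  (λ αi∈ → Vecₚ.lookup⇒[]= _ _ (trans (sym lookup-image) (Vecₚ.[]=⇒lookup αi∈)))
  where
  lookup-image : lookup (image α s) (α ⟨$⟩ʳ i) ≡ lookup s i
  lookup-image = trans (Vecₚ.lookup∘tabulate _ (α ⟨$⟩ʳ i)) (cong (lookup s) (Perm.inverseˡ α))

private
  module Σ = Sum ℕₚ.+-0-commutativeMonoid

  ∣tabulate∣ : ∀ {p} (f : Fin p → Bool) → ∣ tabulate f ∣ ≡ Σ.sum (λ i → if f i then 1 else 0)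
  ∣tabulate∣ {zero}  f = refl
  ∣tabulate∣ {suc p} f with f zero
  ... | true  = cong suc (∣tabulate∣ (f ∘ suc))
  ... | false = ∣tabulate∣ (f ∘ suc)

image-size : ∀ {p} (α : Permutation′ p) (s : Subset p) → ∣ image α s ∣ ≡ ∣ s ∣
image-size α s = begin
  ∣ image α s ∣                                          ≡⟨ ∣tabulate∣ (λ i → lookup s (α ⟨$⟩ˡ i)) ⟩
  Σ.sum (λ i → if lookup s (α ⟨$⟩ˡ i) then 1 else 0)     ≡⟨ Σ.sum-permute (λ i → if lookup s i then 1 else 0) (Perm.flip α) ⟨
  Σ.sum (λ i → if lookup s i then 1 else 0)              ≡⟨ ∣tabulate∣ (lookup s) ⟨
  ∣ tabulate (lookup s) ∣                                ≡⟨ cong ∣_∣ (Vecₚ.tabulate∘lookup s) ⟩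
  ∣ s ∣                                                  ∎
  where open ≡-Reasoning

image-id : ∀ {p} (s : Subset p) → image Perm.id s ≡ s
image-id = Vecₚ.tabulate∘lookup

image-∘ : ∀ {p} (α β : Permutation′ p) s → image α (image β s) ≡ image (α ↔-∘ β) s
image-∘ α β s = Vecₚ.tabulate-cong (λ i → Vecₚ.lookup∘tabulate _ (α ⟨$⟩ˡ i))

image-cancelˡ : ∀ {p} (α : Permutation′ p) s → image α (image (↔-sym α) s) ≡ s
image-cancelˡ α s = trans (image-∘ α (↔-sym α) s)
  (trans (Vecₚ.tabulate-cong (λ i → cong (lookup s) (Perm.inverseʳ α))) (Vecₚ.tabulate∘lookup s))

image-cancelʳ : ∀ {p} (α : Permutation′ p) s → image (↔-sym α) (image α s) ≡ s
image-cancelʳ α s = trans (image-∘ (↔-sym α) α s)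
  (trans (Vecₚ.tabulate-cong (λ i → cong (lookup s) (Perm.inverseˡ α))) (Vecₚ.tabulate∘lookup s))

module _ {p : ℕ} (r : ℕ) where

  rImage : Permutation′ p → RSubset p r → RSubset p r
  rImage α = Refinement.map (image α) (λ {s} → trans (image-size α s))

  induced : Permutation′ p → Permutation (RSubsetSet p r)
  induced α = mk↔ₛ′ (rImage α) (rImage (↔-sym α))
    (λ s → value-injective (image-cancelˡ α (value s)))
    (λ s → value-injective (image-cancelʳ α (value s)))

  private
    P = permSetoid (FinSet p)
    Q = permSetoid (RSubsetSet p r)
    module P = Setoid P
    module Q = Setoid Q
    open Membership P using () renaming (_∈_ to _∈ᴾ_)
    open Membership Q using () renaming (_∈_ to _∈ᴽ_)

    to-from : ∀ {α β : Permutation′ p} → α Perm.≈ β → ∀ i → α ⟨$⟩ˡ i ≡ β ⟨$⟩ˡ i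
    to-from {α} {β} eq i = trans (cong (α ⟨$⟩ˡ_) (sym (trans (eq _) (Perm.inverseʳ β)))) (Perm.inverseˡ α)

    induced-cong : ∀ {α β} → α P.≈ β → induced α Q.≈ induced β
    induced-cong {α} {β} eq s =
      value-injective (Vecₚ.tabulate-cong (λ i → cong (lookup (value s)) (to-from {α} {β} eq i)))

    sym-cong : ∀ {σ τ} → σ Q.≈ τ → ↔-sym σ Q.≈ ↔-sym τ
    sym-cong {σ} {τ} eq s =
      trans (cong (Inverse.from σ) (sym (trans (eq _) (Inverse.strictlyInverseˡ τ s))))
            (Inverse.strictlyInverseʳ σ _)

  -- For r = 0 or r ≥ p distinct α may induce the same permutation, and the
  -- group consists of the distinct induced permutations.
  inducedGroup : PermutationGroup (FinSet p) → PermutationGroup (RSubsetSet p r)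
  inducedGroup A = record
    { elements  = es
    ; unique    = UniqueDSₚ.deduplicate-! DQ (map induced A.elements)
    ; id-closed = intro {↔-id _} (↔-id _) A.id-closed (λ s → value-injective (sym (image-id (value s))))
    ; ∘-closed  = λ {σ} {τ} → ∘-closed′ {σ} {τ}
    ; ⁻¹-closed = λ {σ} → ⁻¹-closed′ {σ}
    }
    where
    module A = PermutationGroup A
    DQ = permDecSetoid (RSubsetSet p r)
    es = deduplicate (DecSetoid._≟_ DQ) (map induced A.elements)

    intro : ∀ {σ} α → α ∈ᴾ A.elements → σ Q.≈ induced α → σ ∈ᴽ es
    intro {σ} α α∈ eq = Membershipₚ.∈-resp-≈ Q {es} {induced α} {σ} (Q.sym {σ} {induced α} eq)
      (Membershipₚ.∈-deduplicate⁺ Q (DecSetoid._≟_ DQ)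
        (λ {σ} {τ} {υ} υ≈τ σ≈τ → Q.trans {σ} {τ} {υ} σ≈τ (Q.sym {υ} {τ} υ≈τ))
        {map induced A.elements} {induced α}
        (Membershipₚ.∈-map⁺ P Q (λ {α} {β} → induced-cong {α} {β}) {α} {A.elements} α∈))

    elim : ∀ {σ} → σ ∈ᴽ es → ∃[ α ] α ∈ᴾ A.elements × σ Q.≈ induced α
    elim {σ} σ∈ = Membershipₚ.∈-map⁻ P Q {σ} {A.elements} {induced}
      (Membershipₚ.∈-deduplicate⁻ Q (DecSetoid._≟_ DQ) (map induced A.elements) {σ} σ∈)

    ∘-closed′ : ∀ {σ τ} → σ ∈ᴽ es → τ ∈ᴽ es → (σ ↔-∘ τ) ∈ᴽ es
    ∘-closed′ {σ} {τ} σ∈ τ∈ with elim {σ} σ∈ | elim {τ} τ∈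
    ... | α , α∈ , σ≈ | β , β∈ , τ≈ = intro {σ ↔-∘ τ} (α ↔-∘ β) (A.∘-closed {α} {β} α∈ β∈)
      (λ s → trans (σ≈ _) (trans (cong (rImage α) (τ≈ s)) (value-injective (image-∘ α β (value s)))))

    ⁻¹-closed′ : ∀ {σ} → σ ∈ᴽ es → ↔-sym σ ∈ᴽ es
    ⁻¹-closed′ {σ} σ∈ with elim {σ} σ∈
    ... | α , α∈ , σ≈ = intro {↔-sym σ} (↔-sym α) (A.⁻¹-closed {α} α∈)
      (sym-cong {σ} {induced α} σ≈)

-- S_p^{(r)}, the r-group of S_p
S⟨_⟩^_ : ∀ p r → PermutationGroup (RSubsetSet p r)
S⟨ p ⟩^ r = inducedGroup r (S p)

module Submission where

-- Class functions on S_n can be summed by recursion on n.  Every permutation of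
-- {0, …, n} is (0 i) ∘ α for a unique i and a unique α fixing 0, and
-- Σᵢ F((0 i) ∘ α) is a class function of α ∈ S_n whenever F is one on S_{n+1}.
-- So weighted class representatives of S_n give weighted representatives of
-- S_{n+1}, and collecting conjugate ones leaves the 30 cycle types of S_9.
-- The cycle monomial of the induced permutation is a class function, because
-- k · j_k is the number of points on cycles of length k; this count is also what
-- is evaluated on each representative.

open import Defs
open import Data.Bool.Base using (if_then_else_; true; false)
open import Data.Bool.Properties using () renaming (_≟_ to _≟ᵇ_)
open import Data.Fin.Base as Fin using (Fin; zero; suc)
open import Data.Fin.Permutation as Perm
  using (Permutation′; _⟨$⟩ʳ_; _⟨$⟩ˡ_; transpose; lift₀; remove; permutation; _∘ₚ_)
import Data.Fin.Permutation.Components as PC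
open import Data.Fin.Properties using (pigeonhole; toℕ<n; suc-injective) renaming (_≟_ to _≟ᶠ_; all? to allᶠ?)
open import Data.Integer.Base as ℤ using (+_)
import Data.Integer.Properties as ℤₚ
open import Data.List.Base as List
  using (List; []; _∷_; _++_; map; filter; length; concat; iterate; takeWhile; applyUpTo; deduplicate;
    foldl; foldr; concatMap; zip; allFin; cartesianProductWith)
import Data.List.Membership.DecPropositional as DecMembership
open import Data.List.Membership.Propositional using (_∈_; find)
open import Data.List.Membership.Propositional.Properties
  using (∈-applyUpTo⁺; ∈-applyUpTo⁻; ∈-map⁺; ∈-concat⁺′; ∈-allFin)
import Data.List.Membership.Setoid as Membership
import Data.List.Membership.Setoid.Properties as Membershipₚ
open import Data.List.Properties
  using (map-∘; map-cong; map-++; length-map; length-++; filter-++; filter-all; filter-none;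
    filter-accept; filter-reject; map-applyUpTo; length-tabulate; ≡-dec)
open import Data.List.Relation.Binary.Permutation.Propositional using (_↭_; ↭-sym; ↭-trans; ↭ₛ⇒↭; ↭-reflexive)
import Data.List.Relation.Binary.Permutation.Propositional.Properties as ↭ₚ
import Data.List.Relation.Binary.Permutation.Setoid as Permutation↭
import Data.List.Relation.Binary.Permutation.Setoid.Properties as Permutation↭ₚ
open import Data.List.Relation.Unary.All as All using (All; []; _∷_)
import Data.List.Relation.Unary.All.Properties as Allₚ
open import Data.List.Relation.Unary.AllPairs as AllPairs using (AllPairs; []; _∷_)
import Data.List.Relation.Unary.AllPairs.Properties as AllPairsₚ
open import Data.List.Relation.Unary.Any as Any using (here; there; Any)
import Data.List.Relation.Unary.Any.Properties as Anyₚ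
import Data.List.Relation.Unary.Unique.DecSetoid.Properties as UniqueDSₚ
open import Data.List.Relation.Unary.Unique.Propositional using (Unique)
import Data.List.Relation.Unary.Unique.Propositional.Properties as Uniqueₚ
import Data.List.Relation.Unary.Unique.Setoid as UniqueS
import Data.List.Relation.Unary.Unique.Setoid.Properties as UniqueSₚ
open import Data.Nat.Base as ℕ using (ℕ; zero; suc; _+_; _*_; _∸_; _≤_; _<_; s<s; s≤s; z≤n; NonZero; _!)
open import Data.Nat.DivMod using (m*n/n≡m)
import Data.Nat.GeneralisedArithmetic as ℕᵍ
open import Data.Nat.ListAction using (sum)
open import Data.Nat.ListAction.Properties using (sum-++)
import Data.Nat.Properties as ℕₚ
open import Data.Product.Base using (∃-syntax; _×_; _,_; proj₁; proj₂)
import Data.Product.Properties as Productₚ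
open import Data.Rational.Base as ℚ using (ℚ; 1ℚ; _/_; toℚᵘ)
import Data.Rational.Properties as ℚₚ
import Data.Rational.Unnormalised.Base as ℚᵘ
import Data.Rational.Unnormalised.Properties as ℚᵘₚ
open import Data.Refinement as Refinement using (value)
open import Data.Vec.Base using (Vec; lookup; tabulate)
import Data.Vec.Properties as Vecₚ
open import Function.Base using (_∘_)
open import Function.Bundles using (Inverse; mk⇔; _↔_; Injection)
open import Function.Construct.Composition using (_↔-∘_)
open import Function.Properties.Inverse using (↔⇒↣)
open import Level using (Level; 0ℓ)
open import Relation.Binary.Bundles using (Setoid; DecSetoid)
open import Relation.Binary.Core using (Rel)
open import Relation.Binary.Definitions using (DecidableEquality) renaming (Decidable to Decidable₂)
open import Relation.Binary.PropositionalEquality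
  using (_≡_; _≢_; refl; sym; trans; cong; cong₂; subst; setoid; module ≡-Reasoning)
open import Relation.Nullary.Decidable
  using (Dec; yes; no; does; ¬?; does-⇔; toWitness; decidable-stable; _→-dec_)
open import Relation.Nullary.Negation using (contradiction; ¬_)

private
  variable
    a b c ℓ : Level
    A : Set a
    B : Set b
    C : Set c
    n p r : ℕ

-- Lists that enumerate the same set

module _ (T : Setoid c ℓ) where
  open Setoid T using (_≈_) renaming (sym to ≈-sym; trans to ≈-trans)
  open Membership T using () renaming (_∈_ to _∈ₛ_)
  open Permutation↭ T using () renaming
    (_↭_ to _↭ₛ_; refl to ≋⇒↭; ↭-refl to ↭ₛ-refl; ↭-trans to ↭ₛ-trans; ↭-sym to ↭ₛ-sym; ↭-prep to ↭ₛ-prep)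

  -- Induction on the first list: its head has an equal in the second, which is shifted to the front
  -- and cancelled; uniqueness keeps the tails equal as sets. The setoid version serves
  -- permutations, which are compared pointwise.
  unique∧set⇒↭ : ∀ {xs ys} → UniqueS.Unique T xs → UniqueS.Unique T ys →
                 (∀ {z} → z ∈ₛ xs → z ∈ₛ ys) → (∀ {z} → z ∈ₛ ys → z ∈ₛ xs) → xs ↭ₛ ys
  unique∧set⇒↭ {[]}     {[]}    _ _ _ _ = ↭ₛ-refl
  unique∧set⇒↭ {[]}     {y ∷ _} _ _ _ ⊇ with () ← ⊇ (here (Setoid.refl T {y}))
  unique∧set⇒↭ {x ∷ xs} {ys} (x∉xs ∷ xs!) ys! ⊆ ⊇
    with as , bs , w , x≈w , ys≋ ← Membershipₚ.∈-∃++ T (⊆ (here (Setoid.refl T)))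
    with ys↭ ← ↭ₛ-trans (≋⇒↭ ys≋) (Permutation↭ₚ.shift T (≈-sym x≈w) as bs)
    with x∉zs ∷ zs! ← Permutation↭ₚ.Unique-resp-↭ T ys↭ ys!
    = ↭ₛ-trans (↭ₛ-prep x (unique∧set⇒↭ xs! zs! xs⊆zs zs⊆xs)) (↭ₛ-sym ys↭)
    where
    xs⊆zs : ∀ {z} → z ∈ₛ xs → z ∈ₛ as ++ bs
    xs⊆zs z∈xs with Permutation↭ₚ.∈-resp-↭ T ys↭ (⊆ (there z∈xs))
    ... | here z≈x = contradiction (Membershipₚ.∈-resp-≈ T z≈x z∈xs) (Allₚ.All¬⇒¬Any x∉xs)
    ... | there z∈ = z∈

    zs⊆xs : ∀ {z} → z ∈ₛ as ++ bs → z ∈ₛ xs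
    zs⊆xs z∈zs with ⊇ (Permutation↭ₚ.∈-resp-↭ T (↭ₛ-sym ys↭) (there z∈zs))
    ... | here z≈x = contradiction (Membershipₚ.∈-resp-≈ T z≈x z∈zs) (Allₚ.All¬⇒¬Any x∉zs)
    ... | there z∈ = z∈

  sum-map-↭ : ∀ {F : Setoid.Carrier T → ℕ} → (∀ {x y} → x ≈ y → F x ≡ F y) →
              ∀ {xs ys} → xs ↭ₛ ys → sum (map F xs) ≡ sum (map F ys)
  sum-map-↭ F-cong xs↭ys = Permutation↭ₚ.foldr-commMonoid (setoid ℕ) ℕₚ.+-0-isCommutativeMonoid
    (Permutation↭ₚ.map⁺ T (setoid ℕ) F-cong xs↭ys)

unique∧set⇒↭ₚ : {xs ys : List A} → Unique xs → Unique ys →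
                (∀ {z} → z ∈ xs → z ∈ ys) → (∀ {z} → z ∈ ys → z ∈ xs) → xs ↭ ys
unique∧set⇒↭ₚ {A = A} xs! ys! ⊆ ⊇ = ↭ₛ⇒↭ (unique∧set⇒↭ (setoid A) xs! ys! ⊆ ⊇)

to-injective : ∀ (π : A ↔ B) {x y} → Inverse.to π x ≡ Inverse.to π y → x ≡ y
to-injective π = Injection.injective (↔⇒↣ π)

applyUpTo-cong : {f g : ℕ → A} → (∀ i → f i ≡ g i) → ∀ n → applyUpTo f n ≡ applyUpTo g n
applyUpTo-cong f≗g zero    = refl
applyUpTo-cong f≗g (suc n) = cong₂ _∷_ (f≗g 0) (applyUpTo-cong (f≗g ∘ suc) n)

occurrences : ℕ → List ℕ → ℕ
occurrences k ls = length (filter (ℕₚ._≟ k) ls)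

occurrences-↭ : ∀ k {ls ls′} → ls ↭ ls′ → occurrences k ls ≡ occurrences k ls′
occurrences-↭ k ls↭ls′ = ↭ₚ.↭-length (↭ₚ.filter-↭ (ℕₚ._≟ k) ls↭ls′)

-- Counting points by the size of their equivalence class

module _ (X : FiniteSet) where
  open FiniteSet X

  -- cyc x plays the role of the cycle through x; leaving it abstract keeps
  -- conversion checking cheap.
  module Classes (cyc : Carrier → List Carrier)
                 (cyc-unique : ∀ x → Unique (cyc x)) (self∈ : ∀ {x} → x ∈ cyc x)
                 (∈-sym : ∀ {x y} → y ∈ cyc x → x ∈ cyc y)
                 (∈-trans : ∀ {x y z} → y ∈ cyc x → z ∈ cyc y → z ∈ cyc x) where
    open ≡-Reasoning

    sameCycle : DecSetoid 0ℓ 0ℓ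
    sameCycle = record
      { Carrier = Carrier
      ; _≈_ = λ x y → y ∈ cyc x
      ; isDecEquivalence = record
        { isEquivalence = record { refl = self∈ ; sym = ∈-sym ; trans = ∈-trans }
        ; _≟_ = λ x y → DecMembership._∈?_ _≟_ y (cyc x)
        }
      }

    representatives : List Carrier
    representatives = deduplicate (λ x y → DecMembership._∈?_ _≟_ y (cyc x)) elements

    -- Deduplication leaves pairwise unrelated representatives, so their classes are disjoint, and
    -- keeps one related to each point, so the classes cover the set.
    elements-↭ : elements ↭ concat (map cyc representatives)
    elements-↭ = unique∧set⇒↭ₚ unique
      (Uniqueₚ.concat⁺ (Allₚ.map⁺ (All.universal cyc-unique representatives))
        (AllPairsₚ.map⁺ (AllPairs.map disjoint (UniqueDSₚ.deduplicate-! sameCycle elements))))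
      (λ {x} _ → covered x)
      (λ {x} _ → complete x)
      where
      disjoint : ∀ {x y} → ¬ y ∈ cyc x → ∀ {z} → ¬ (z ∈ cyc x × z ∈ cyc y)
      disjoint y∉ (z∈x , z∈y) = y∉ (∈-trans z∈x (∈-sym z∈y))

      covered : ∀ x → x ∈ concat (map cyc representatives)
      covered x with r , r∈ , x∈r ← find (Membershipₚ.∈-deduplicate⁺
          (DecSetoid.setoid sameCycle) (DecSetoid._≟_ sameCycle)
          (λ y∈z y∈x → ∈-trans y∈x (∈-sym y∈z)) {elements} (Any.map (λ { refl → self∈ }) (complete x)))
        = ∈-concat⁺′ (∈-sym x∈r) (∈-map⁺ cyc r∈)

    classSize : Carrier → ℕ
    classSize x = length (cyc x)

    classSize-const : ∀ {x y} → y ∈ cyc x → classSize y ≡ classSize x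
    classSize-const {x} {y} y∈ = ↭ₚ.↭-length (unique∧set⇒↭ₚ (cyc-unique y) (cyc-unique x)
      (∈-trans y∈) (∈-trans (∈-sym y∈)))

    module _ (k : ℕ) where
      occurrences-class : ∀ x → classSize x ≡ k → occurrences k (map classSize (cyc x)) ≡ k
      occurrences-class x len≡k = begin
        occurrences k (map classSize (cyc x))  ≡⟨ cong length (filter-all (ℕₚ._≟ k) (Allₚ.map⁺ (All.tabulate same))) ⟩
        length (map classSize (cyc x))         ≡⟨ length-map classSize (cyc x) ⟩
        classSize x                            ≡⟨ len≡k ⟩
        k                                      ∎
        where
        same : ∀ {y} → y ∈ cyc x → classSize y ≡ k
        same y∈ = trans (classSize-const y∈) len≡k

      occurrences-class-≢ : ∀ x → classSize x ≢ k → occurrences k (map classSize (cyc x)) ≡ 0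
      occurrences-class-≢ x len≢k = cong length (filter-none (ℕₚ._≟ k)
        (Allₚ.map⁺ (All.tabulate λ y∈ eq → len≢k (trans (sym (classSize-const y∈)) eq))))

      -- The size is constant along a class, so a class of size `k` contributes `k` entries equal to
      -- `k` and any other class contributes none.
      occurrences-concat : ∀ rs → occurrences k (map classSize (concat (map cyc rs))) ≡
                           length (filter (λ c → length c ℕₚ.≟ k) (map cyc rs)) * k
      occurrences-concat []       = refl
      occurrences-concat (r ∷ rs) = trans split (by-cases (classSize r ℕₚ.≟ k))
        where
        rest = map classSize (concat (map cyc rs))

        split : occurrences k (map classSize (cyc r ++ concat (map cyc rs))) ≡
                occurrences k (map classSize (cyc r)) + occurrences k rest
        split = begin
          occurrences k (map classSize (cyc r ++ concat (map cyc rs)))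
            ≡⟨ cong (occurrences k) (map-++ classSize (cyc r) _) ⟩
          occurrences k (map classSize (cyc r) ++ rest)
            ≡⟨ cong length (filter-++ (ℕₚ._≟ k) (map classSize (cyc r)) rest) ⟩
          length (filter (ℕₚ._≟ k) (map classSize (cyc r)) ++ filter (ℕₚ._≟ k) rest)
            ≡⟨ length-++ (filter (ℕₚ._≟ k) (map classSize (cyc r))) ⟩
          occurrences k (map classSize (cyc r)) + occurrences k rest ∎

        by-cases : Dec (classSize r ≡ k) →
                   occurrences k (map classSize (cyc r)) + occurrences k rest ≡
                   length (filter (λ c → length c ℕₚ.≟ k) (cyc r ∷ map cyc rs)) * k
        by-cases (yes len≡k) = trans (cong₂ _+_ (occurrences-class r len≡k) (occurrences-concat rs))
          (cong (λ cs → length cs * k) (sym (filter-accept (λ c → length c ℕₚ.≟ k) {cyc r} len≡k)))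
        by-cases (no len≢k)  = trans (cong₂ _+_ (occurrences-class-≢ r len≢k) (occurrences-concat rs))
          (cong (λ cs → length cs * k) (sym (filter-reject (λ c → length c ℕₚ.≟ k) {cyc r} len≢k)))

    occurrences-classSizes : ∀ k → occurrences k (map classSize elements) ≡
      length (filter (λ c → length c ℕₚ.≟ k) (map cyc representatives)) * k
    occurrences-classSizes k = trans (occurrences-↭ k (↭ₚ.map⁺ classSize elements-↭))
      (occurrences-concat k representatives)

-- The cycles of a permutation

module _ {X : FiniteSet} (α : Permutation X) where
  open FiniteSet X
  open Inverse α using () renaming (to to f)
  open ≡-Reasoning

  private
    f^ : ℕ → Carrier → Carrier
    f^ n x = ℕᵍ.iterate f x n

    iterate-suc : ∀ n x → f^ (suc n) x ≡ f (f^ n x)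
    iterate-suc zero    x = refl
    iterate-suc (suc n) x = iterate-suc n (f x)

    iterate-+ : ∀ m n x → f^ (m + n) x ≡ f^ n (f^ m x)
    iterate-+ zero    n x = refl
    iterate-+ (suc m) n x = iterate-+ m n (f x)

    iterate-cancel : ∀ m n x → f^ m x ≡ f^ (m + n) x → x ≡ f^ n x
    iterate-cancel zero    n x eq = eq
    iterate-cancel (suc m) n x eq =
      to-injective α (trans (iterate-cancel m n (f x) eq) (iterate-suc n x))

    -- Injectivity cancels the first `i` steps. The return time is `suc d`, that is `k ∸ i`, written
    -- so as to be visibly positive.
    iterate-collision : ∀ {x i k} → i < k → f^ i x ≡ f^ k x → ∃[ d ] d < k × f^ (suc d) x ≡ x
    iterate-collision {x} {i} {k} i<k eq with d , refl ← ℕₚ.m≤n⇒∃[o]m+o≡n i<k =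
      d , s≤s (ℕₚ.m≤n+m d i) ,
      sym (iterate-cancel i (suc d) x (trans eq (cong (λ k → f^ k x) (sym (ℕₚ.+-suc i d)))))

    -- Pigeonhole on the positions in `elements` of the `size + 1` iterates from `f^ 0 x` to
    -- `f^ size x`. This is why the bound in `cycleThrough` cuts nothing off.
    returns : ∀ x → ∃[ n ] n < size × f^ (suc n) x ≡ x
    returns x
      with i , k , i<k , eq ← pigeonhole (ℕₚ.n<1+n size) (λ i → Any.index (complete (f^ (Fin.toℕ i) x)))
      with d , d<k , r ← iterate-collision i<k
        (trans (Anyₚ.lookup-index (complete _))
          (trans (cong (List.lookup elements) eq) (sym (Anyₚ.lookup-index (complete _)))))
      = d , ℕₚ.<-≤-trans d<k (ℕₚ.≤-pred (toℕ<n k)) , r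

    -- Since `x` is hit at some time `n` below the bound `N`, `takeWhile` stops at `x` and not at
    -- the end of the list; `m` is the first hitting time.
    takeWhile-iterate : ∀ {x} y n {N} → n < N → f^ n y ≡ x → ∃[ m ]
      takeWhile (λ z → ¬? (z ≟ x)) (iterate f y N) ≡ applyUpTo (λ i → f^ i y) m ×
      f^ m y ≡ x × (∀ {i} → i < m → f^ i y ≢ x)
    takeWhile-iterate {x} y n {suc N} n<N r with y ≟ x
    ... | yes y≡x = 0 , refl , y≡x , λ ()
    takeWhile-iterate {x} y zero    {suc N} n<N       r | no y≢x = contradiction r y≢x
    takeWhile-iterate {x} y (suc n) {suc N} (s<s n<N) r | no y≢x
      with m , eq , r′ , min ← takeWhile-iterate (f y) n n<N r
      = suc m , cong (y ∷_) eq , r′ , λ { {zero} _ → y≢x ; {suc i} (s<s i<m) → min i<m }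

    -- Here `suc m` is the least period of `x`. The facts in `Cycles` are derived from this
    -- description alone.
    Periodic : (Carrier → List Carrier) → Set
    Periodic cyc = ∀ x → ∃[ m ] cyc x ≡ applyUpTo (λ i → f^ i x) (suc m) ×
      f^ (suc m) x ≡ x × (∀ {i} → i < m → f^ (suc i) x ≢ x)

    cycleThrough-periodic : Periodic (cycleThrough {X} α)
    cycleThrough-periodic x with n , n<size , r ← returns x
      with m , eq , r′ , min ← takeWhile-iterate (f x) n n<size r
      = m , cong (x ∷_) eq , r′ , min

    module Cycles (cyc : Carrier → List Carrier) (period : Periodic cyc) where

      cyc-unique : ∀ x → Unique (cyc x)
      cyc-unique x =
        let m , eq , _ , min = period x in
        -- Two equal entries would give a return to `x` before the least period.
        subst Unique (sym eq) (Uniqueₚ.applyUpTo⁺₁ (λ i → f^ i x) (suc m) λ i<k k≤m eq →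
          let d , d<k , r = iterate-collision i<k eq in min (ℕₚ.<-≤-trans d<k (ℕₚ.≤-pred k≤m)) r)

      ∈-cyc⁺ : ∀ n x → f^ n x ∈ cyc x
      ∈-cyc⁺ n x =
        let m , eq , r , _ = period x
            i , i≤m , eqᵢ = reach r n
        in subst (f^ n x ∈_) (sym eq) (subst (_∈ applyUpTo (λ i → f^ i x) (suc m)) (sym eqᵢ)
             (∈-applyUpTo⁺ (λ i → f^ i x) (s≤s i≤m)))
        where
        next : ∀ {n i} → f^ n x ≡ f^ i x → f^ (suc n) x ≡ f^ (suc i) x
        next {n} {i} eq = trans (iterate-suc n x) (trans (cong f eq) (sym (iterate-suc i x)))

        reach : ∀ {m} → f^ (suc m) x ≡ x → ∀ n → ∃[ i ] i ≤ m × f^ n x ≡ f^ i x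
        reach r zero = 0 , z≤n , refl
        reach {m} r (suc n) with i , i≤m , eqᵢ ← reach r n with i ℕₚ.≟ m
        -- The step after exponent `m` completes the period, so the exponent wraps around to 0.
        ... | yes refl = 0 , z≤n , trans (next {n} {i} eqᵢ) r
        ... | no i≢m   = suc i , ℕₚ.≤∧≢⇒< i≤m i≢m , next {n} {i} eqᵢ

      ∈-cyc⁻ : ∀ {x y} → y ∈ cyc x → ∃[ i ] i < suc (proj₁ (period x)) × y ≡ f^ i x
      ∈-cyc⁻ {x} {y} y∈ = ∈-applyUpTo⁻ (λ i → f^ i x) (subst (y ∈_) (proj₁ (proj₂ (period x))) y∈)

      -- If `y` is reached from `x` in `i` steps, the remaining `suc m ∸ i` steps of the period lead
      -- back from `y` to `x`.
      ∈-cyc-sym : ∀ {x y} → y ∈ cyc x → x ∈ cyc y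
      ∈-cyc-sym {x} {y} y∈ =
        let m , _ , r , _ = period x
            i , i≤m , y≡ = ∈-cyc⁻ y∈
        in subst (_∈ cyc y) (back i≤m y≡ r) (∈-cyc⁺ (suc m ∸ i) y)
        where
        back : ∀ {i m} → i < suc m → y ≡ f^ i x → f^ (suc m) x ≡ x → f^ (suc m ∸ i) y ≡ x
        back {i} {m} i≤m y≡ r = begin
          f^ (suc m ∸ i) y           ≡⟨ cong (f^ (suc m ∸ i)) y≡ ⟩
          f^ (suc m ∸ i) (f^ i x)    ≡⟨ iterate-+ i (suc m ∸ i) x ⟨
          f^ (i + (suc m ∸ i)) x     ≡⟨ cong (λ n → f^ n x) (ℕₚ.m+[n∸m]≡n (ℕₚ.<⇒≤ i≤m)) ⟩
          f^ (suc m) x               ≡⟨ r ⟩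
          x                          ∎

      ∈-cyc-trans : ∀ {x y z} → y ∈ cyc x → z ∈ cyc y → z ∈ cyc x
      ∈-cyc-trans {x} {y} y∈ z∈ =
        let i , _ , y≡ = ∈-cyc⁻ y∈
            k , _ , z≡ = ∈-cyc⁻ z∈
        in subst (_∈ cyc x) (trans (iterate-+ i k x) (sym (trans z≡ (cong (f^ k) y≡)))) (∈-cyc⁺ (i + k) x)

  cycleLengths : List ℕ
  cycleLengths = map (λ x → length (cycleThrough {X} α x)) elements

  occurrences-cycleLengths : ∀ k → occurrences k cycleLengths ≡ j {X} k α * k
  occurrences-cycleLengths = Classes.occurrences-classSizes X (cycleThrough {X} α)
    cyc-unique (here refl) ∈-cyc-sym ∈-cyc-trans
    where open Cycles (cycleThrough {X} α) cycleThrough-periodic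

-- Every k-cycle contributes k occurrences of its length k, one for each point.
lengthsMonomial : ℕ → List ℕ → Monomial
lengthsMonomial n ls = applyUpTo (λ i → suc i , occurrences (suc i) ls ℕ./ suc i) n

lengthsMonomial-↭ : ∀ n {ls ls′} → ls ↭ ls′ → lengthsMonomial n ls ≡ lengthsMonomial n ls′
lengthsMonomial-↭ n ls↭ls′ =
  applyUpTo-cong (λ i → cong (λ c → suc i , c ℕ./ suc i) (occurrences-↭ (suc i) ls↭ls′)) n

-- The cycle monomial and its invariance under conjugation

module _ {X : FiniteSet} where
  open FiniteSet X

  -- Dividing the number of points on `k`-cycles by `k` recovers `j k`. The right-hand side depends
  -- only on the multiset of lengths and involves no choice of one point per cycle.
  cycleMonomial-lengths : ∀ α → cycleMonomial {X} α ≡ lengthsMonomial size (cycleLengths {X} α)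
  cycleMonomial-lengths α = trans (map-applyUpTo suc (λ k → k , j {X} k α) size)
    (applyUpTo-cong (λ i → cong (suc i ,_) (exponents i)) size)
    where
    exponents : ∀ i → j {X} (suc i) α ≡ occurrences (suc i) (cycleLengths {X} α) ℕ./ suc i
    exponents i = sym (trans (cong (ℕ._/ suc i) (occurrences-cycleLengths {X} α (suc i)))
      (m*n/n≡m (j {X} (suc i) α) (suc i)))

  module _ {α β : Permutation X} (τ : Permutation X)
           (τα≗βτ : ∀ x → Inverse.to τ (Inverse.to α x) ≡ Inverse.to β (Inverse.to τ x)) where

    private
      t = Inverse.to τ

      cycleThrough-conj : ∀ x → cycleThrough {X} β (t x) ≡ map t (cycleThrough {X} α x)
      cycleThrough-conj x = cong (t x ∷_) (trans
        (cong (λ y → takeWhile (λ y → ¬? (y ≟ t x)) (iterate (Inverse.to β) y size)) (sym (τα≗βτ x)))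
        (go (Inverse.to α x) size))
        where
        go : ∀ y n → takeWhile (λ y → ¬? (y ≟ t x)) (iterate (Inverse.to β) (t y) n) ≡
                     map t (takeWhile (λ y → ¬? (y ≟ x)) (iterate (Inverse.to α) y n))
        go y zero    = refl
        go y (suc n) with y ≟ x | t y ≟ t x
        ... | yes _    | yes _     = refl
        ... | yes refl | no ty≢tx  = contradiction refl ty≢tx
        ... | no y≢x   | yes ty≡tx = contradiction (to-injective τ ty≡tx) y≢x
        ... | no _     | no _      = cong (t y ∷_)
          (trans (cong (λ z → takeWhile _ (iterate (Inverse.to β) z n)) (sym (τα≗βτ y)))
            (go (Inverse.to α y) n))

      elements-map : map t elements ↭ elements
      elements-map = unique∧set⇒↭ₚ (Uniqueₚ.map⁺ (to-injective τ) unique) unique (λ {x} _ → complete x)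
        (λ {x} _ → subst (_∈ map t elements) (Inverse.strictlyInverseˡ τ x) (∈-map⁺ t (complete _)))

    -- `τ` carries the cycle of `α` through `x` onto the cycle of `β` through `τ x`, and it only
    -- reorders the points.
    cycleLengths-conj : cycleLengths {X} β ↭ cycleLengths {X} α
    cycleLengths-conj = ↭-trans (↭-sym (↭ₚ.map⁺ _ elements-map))
      (↭-reflexive (trans (sym (map-∘ elements))
        (map-cong (λ x → trans (cong length (cycleThrough-conj x)) (length-map t (cycleThrough {X} α x))) elements)))

    cycleMonomial-conj : cycleMonomial {X} β ≡ cycleMonomial {X} α
    cycleMonomial-conj = trans (cycleMonomial-lengths β)
      (trans (lengthsMonomial-↭ size cycleLengths-conj) (sym (cycleMonomial-lengths α)))

-- Sums over lists

sum-map-cartesianProductWith : ∀ (F : C → ℕ) (f : A → B → C) xs ys →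
  sum (map F (cartesianProductWith f xs ys)) ≡ sum (map (λ x → sum (map (F ∘ f x) ys)) xs)
sum-map-cartesianProductWith F f []       ys = refl
sum-map-cartesianProductWith F f (x ∷ xs) ys = begin
  sum (map F (map (f x) ys ++ cartesianProductWith f xs ys))
    ≡⟨ cong sum (map-++ F (map (f x) ys) _) ⟩
  sum (map F (map (f x) ys) ++ map F (cartesianProductWith f xs ys))
    ≡⟨ sum-++ (map F (map (f x) ys)) _ ⟩
  sum (map F (map (f x) ys)) + sum (map F (cartesianProductWith f xs ys))
    ≡⟨ cong₂ _+_ (cong sum (sym (map-∘ ys))) (sum-map-cartesianProductWith F f xs ys) ⟩
  sum (map (F ∘ f x) ys) + sum (map (λ x → sum (map (F ∘ f x) ys)) xs) ∎
  where open ≡-Reasoning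

sum-map-* : ∀ w (F : A → ℕ) xs → sum (map (λ x → w * F x) xs) ≡ w * sum (map F xs)
sum-map-* w F []       = sym (ℕₚ.*-zeroʳ w)
sum-map-* w F (x ∷ xs) = trans (cong (λ z → w * F x + z) (sum-map-* w F xs))
  (sym (ℕₚ.*-distribˡ-+ w (F x) _))

-- Formal sums with natural coefficients

Weighted : Set a → Set a
Weighted A = List (ℕ × A)

weightedSum : (A → ℕ) → Weighted A → ℕ
weightedSum F t = sum (map (λ p → proj₁ p * F (proj₂ p)) t)

module _ (T : DecSetoid c ℓ) where
  open DecSetoid T using (Carrier; _≈_; _≟_)

  -- A like term already present keeps its position and its representative; `expansion` relies on
  -- this to reproduce a given list exactly.
  add : ℕ × Carrier → Weighted Carrier → Weighted Carrier
  add (w , x) []            = (w , x) ∷ []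
  add (w , x) ((v , y) ∷ t) = if does (x ≟ y) then (w + v , y) ∷ t else (v , y) ∷ add (w , x) t

  module _ {F : Carrier → ℕ} (F-cong : ∀ {x y} → x ≈ y → F x ≡ F y) where
    open ≡-Reasoning

    weightedSum-add : ∀ w x t → weightedSum F (add (w , x) t) ≡ w * F x + weightedSum F t
    weightedSum-add w x []            = refl
    weightedSum-add w x ((v , y) ∷ t) with x ≟ y
    ... | yes x≈y = begin
      (w + v) * F y + weightedSum F t       ≡⟨ cong (_+ weightedSum F t) (ℕₚ.*-distribʳ-+ (F y) w v) ⟩
      w * F y + v * F y + weightedSum F t   ≡⟨ ℕₚ.+-assoc (w * F y) _ _ ⟩
      w * F y + (v * F y + weightedSum F t) ≡⟨ cong (λ c → w * c + (v * F y + weightedSum F t)) (F-cong x≈y) ⟨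
      w * F x + (v * F y + weightedSum F t) ∎
    ... | no _ = begin
      v * F y + weightedSum F (add (w , x) t) ≡⟨ cong (λ z → v * F y + z) (weightedSum-add w x t) ⟩
      v * F y + (w * F x + weightedSum F t)   ≡⟨ ℕₚ.+-assoc (v * F y) _ _ ⟨
      v * F y + w * F x + weightedSum F t     ≡⟨ cong (_+ weightedSum F t) (ℕₚ.+-comm (v * F y) (w * F x)) ⟩
      w * F x + v * F y + weightedSum F t     ≡⟨ ℕₚ.+-assoc (w * F x) _ _ ⟩
      w * F x + (v * F y + weightedSum F t)   ∎

    weightedSum-collect : ∀ s t → weightedSum F (foldr add s t) ≡ weightedSum F t + weightedSum F s
    weightedSum-collect s []            = refl
    weightedSum-collect s ((w , x) ∷ t) = begin
      weightedSum F (add (w , x) (foldr add s t))     ≡⟨ weightedSum-add w x (foldr add s t) ⟩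
      w * F x + weightedSum F (foldr add s t)         ≡⟨ cong (λ z → w * F x + z) (weightedSum-collect s t) ⟩
      w * F x + (weightedSum F t + weightedSum F s)   ≡⟨ ℕₚ.+-assoc (w * F x) _ _ ⟨
      w * F x + weightedSum F t + weightedSum F s     ∎

-- Class functions on the symmetric group

Conjugates : (τ α β : Permutation′ n) → Set
Conjugates τ α β = ∀ i → τ ⟨$⟩ʳ (α ⟨$⟩ʳ i) ≡ β ⟨$⟩ʳ (τ ⟨$⟩ʳ i)

ClassFunction : (Permutation′ n → ℕ) → Set
ClassFunction F = ∀ τ {α β} → Conjugates τ α β → F α ≡ F β

-- Pointwise equal permutations are conjugate by the identity.
ClassFunction-cong : ∀ {F : Permutation′ n → ℕ} → ClassFunction F → ∀ {α β} → α Perm.≈ β → F α ≡ F β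
ClassFunction-cong F-class α≈β = F-class Perm.id α≈β

transpose-conj : ∀ (τ : Permutation′ n) i k x →
  τ ⟨$⟩ʳ PC.transpose i k x ≡ PC.transpose (τ ⟨$⟩ʳ i) (τ ⟨$⟩ʳ k) (τ ⟨$⟩ʳ x)
transpose-conj τ i k x with x ≟ᶠ i | τ ⟨$⟩ʳ x ≟ᶠ τ ⟨$⟩ʳ i
... | yes _    | yes _  = refl
... | yes refl | no ≢   = contradiction refl ≢
... | no ≢     | yes eq = contradiction (to-injective τ eq) ≢
... | no _     | no _ with x ≟ᶠ k | τ ⟨$⟩ʳ x ≟ᶠ τ ⟨$⟩ʳ k
...   | yes _    | yes _  = refl
...   | yes refl | no ≢   = contradiction refl ≢
...   | no ≢     | yes eq = contradiction (to-injective τ eq) ≢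
...   | no _     | no _   = refl

-- (0 i) ∘ α, with α acting on the points other than 0.
attach : Permutation′ n → Fin (suc n) → Permutation′ (suc n)
attach α i = lift₀ α ∘ₚ transpose zero i

-- `lift₀ τ` fixes 0, so conjugation by it turns the transposition (0 i) into (0 τi).
attach-conj : ∀ {τ α β : Permutation′ n} → Conjugates τ α β →
              ∀ i → Conjugates (lift₀ τ) (attach α i) (attach β (lift₀ τ ⟨$⟩ʳ i))
attach-conj {τ = τ} {α} {β} conj i x = trans (transpose-conj (lift₀ τ) zero i (lift₀ α ⟨$⟩ʳ x))
  (cong (PC.transpose zero (lift₀ τ ⟨$⟩ʳ i)) (lift-conj x))
  where
  lift-conj : Conjugates (lift₀ τ) (lift₀ α) (lift₀ β)
  lift-conj zero    = refl
  lift-conj (suc x) = cong suc (conj x)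

-- The value at `zero` is the attached point; once these agree, the common transposition cancels.
attach-injective : ∀ {α β : Permutation′ n} {i k} → attach α i Perm.≈ attach β k → α Perm.≈ β × i ≡ k
attach-injective {i = i} eq with refl ← eq zero =
  (λ x → suc-injective (to-injective (transpose zero i) (eq (suc x)))) , refl

attach-cong : ∀ {α β : Permutation′ n} {i k} → α Perm.≈ β → i ≡ k → attach α i Perm.≈ attach β k
attach-cong eq refl zero    = refl
attach-cong {i = i} eq refl (suc x) = cong (λ y → PC.transpose zero i (suc y)) (eq x)

-- `σ` followed by the transposition of `σ 0` and 0 fixes 0, so `remove` merely restricts it to the
-- other points.
detach : Permutation′ (suc n) → Permutation′ n
detach σ = remove zero (σ ∘ₚ transpose (σ ⟨$⟩ʳ zero) zero)

attach-detach : ∀ (σ : Permutation′ (suc n)) → attach (detach σ) (σ ⟨$⟩ʳ zero) Perm.≈ σ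
attach-detach σ x = trans
  -- `transpose-inverse` at `zero` says that the corrected permutation fixes `zero`, because
  -- `transpose zero i zero` reduces to `i`.
  (cong (PC.transpose zero i) (Perm.lift₀-remove (σ ∘ₚ transpose i zero) (PC.transpose-inverse i zero {zero}) x))
  (PC.transpose-inverse zero i)
  where i = σ ⟨$⟩ʳ zero

sum-attach : (Permutation′ (suc n) → ℕ) → Permutation′ n → ℕ
sum-attach {n} F α = sum (map (F ∘ attach α) (allFin (suc n)))

-- `permutations` is built by `insert`, whereas `attach` is compatible with conjugation. Both
-- enumerate the symmetric group once, up to pointwise equality, which `F` respects.
permutations-attach : ∀ n {F : Permutation′ (suc n) → ℕ} → ClassFunction F →
  sum (map F (permutations (suc n))) ≡ sum (map (sum-attach F) (permutations n))
permutations-attach n {F} F-class = trans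
  (sum-map-↭ P′ (λ {α} {β} → ClassFunction-cong F-class {α} {β})
    (unique∧set⇒↭ P′ (permutations-unique (suc n)) unique (λ {σ} _ → complete σ) (λ {σ} _ → permutations-complete σ)))
  (sum-map-cartesianProductWith F attach (permutations n) (allFin (suc n)))
  where
  P  = permSetoid (FinSet n)
  P′ = permSetoid (FinSet (suc n))

  unique : UniqueS.Unique P′ (cartesianProductWith attach (permutations n) (allFin (suc n)))
  unique = UniqueSₚ.cartesianProductWith⁺ P (setoid (Fin (suc n))) P′ attach
    (λ {α} {β} {i} {k} → attach-injective {α = α} {β} {i} {k})
    (permutations-unique n) (Uniqueₚ.allFin⁺ (suc n))

  complete : ∀ σ → Membership._∈_ P′ σ (cartesianProductWith attach (permutations n) (allFin (suc n)))
  complete σ = Membershipₚ.∈-resp-≈ P′ {cartesianProductWith attach (permutations n) (allFin (suc n))}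
    {attach (detach σ) (σ ⟨$⟩ʳ zero)} {σ} (attach-detach σ)
    (Membershipₚ.∈-cartesianProductWith⁺ P (setoid (Fin (suc n))) P′ {f = attach}
      (λ {α} {β} {i} {k} → attach-cong {α = α} {β} {i} {k})
      (permutations-complete (detach σ)) (∈-allFin (σ ⟨$⟩ʳ zero)))

-- Conjugation by `lift₀ τ` matches the summand of `α` at `i` with that of `β` at `τ₀ i`, and `τ₀`
-- permutes the points.
attach-classFunction : ∀ {F : Permutation′ (suc n) → ℕ} → ClassFunction F →
                       ClassFunction (sum-attach F)
attach-classFunction {n} {F} F-class τ {α} {β} conj = begin
  sum (map (F ∘ attach α) points)          ≡⟨ cong sum (map-cong pointwise points) ⟩
  sum (map (F ∘ attach β ∘ τ₀) points)     ≡⟨ cong sum (map-∘ points) ⟩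
  sum (map (F ∘ attach β) (map τ₀ points)) ≡⟨ sum-map-↭ (setoid _) (cong (F ∘ attach β)) reindex ⟩
  sum (map (F ∘ attach β) points)          ∎
  where
  open ≡-Reasoning
  points = allFin (suc n)
  τ₀ = lift₀ τ ⟨$⟩ʳ_

  pointwise : ∀ i → F (attach α i) ≡ F (attach β (τ₀ i))
  pointwise i = F-class (lift₀ τ) (attach-conj {τ = τ} {α} {β} conj i)

  reindex = unique∧set⇒↭ (setoid (Fin (suc n)))
    (Uniqueₚ.map⁺ (to-injective (lift₀ τ)) (Uniqueₚ.allFin⁺ (suc n))) (Uniqueₚ.allFin⁺ (suc n))
    (λ {i} _ → ∈-allFin i)
    (λ {i} _ → subst (_∈ map τ₀ (allFin (suc n))) (Perm.inverseʳ (lift₀ τ))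
      (∈-map⁺ τ₀ (∈-allFin (lift₀ τ ⟨$⟩ˡ i))))

-- Conjugacy class representatives

-- Permutations stored as tables, so that evaluation computes each value only once.
fromTables : (to from : Vec (Fin n) n) → (∀ i → lookup to (lookup from i) ≡ i) →
             (∀ i → lookup from (lookup to i) ≡ i) → Permutation′ n
fromTables to from = permutation (lookup to) (lookup from)

tabulated : Permutation′ n → Permutation′ n
tabulated π = fromTables (tabulate (π ⟨$⟩ʳ_)) (tabulate (π ⟨$⟩ˡ_))
  (λ i → trans (Vecₚ.lookup∘tabulate _ (lookup (tabulate (π ⟨$⟩ˡ_)) i))
    (trans (cong (π ⟨$⟩ʳ_) (Vecₚ.lookup∘tabulate _ i)) (Perm.inverseʳ π)))
  (λ i → trans (Vecₚ.lookup∘tabulate _ (lookup (tabulate (π ⟨$⟩ʳ_)) i))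
    (trans (cong (π ⟨$⟩ˡ_) (Vecₚ.lookup∘tabulate _ i)) (Perm.inverseˡ π)))

-- Numbering the points in this order turns a permutation into cycles on consecutive blocks of
-- increasing length, a form fixed by its cycle type.
byLength : ℕ → List (List A) → List A
byLength n cs = concatMap (λ k → concat (filter (λ c → length c ℕₚ.≟ k) cs)) (applyUpTo suc n)

-- Sends the i-th point to the i-th entry of w if w lists every point once, and is
-- a permutation in any case.
arrange : List (Fin n) → Permutation′ n
arrange w = foldl (λ τ p → τ ∘ₚ transpose (τ ⟨$⟩ʳ proj₁ p) (proj₂ p)) Perm.id (zip (allFin _) w)

conjugate : Permutation′ n → Permutation′ n → Permutation′ n
conjugate τ α = tabulated (τ ∘ₚ α ∘ₚ Perm.flip τ)

-- Depends only on the cycle type of α, which is what makes `classes` short; the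
-- proofs use only that it is conjugate to α.
normalForm : Permutation′ n → Permutation′ n
normalForm {n} α = conjugate (arrange (byLength n (cycles {FinSet n} α))) α

normalForm-class : ∀ {F : Permutation′ n → ℕ} → ClassFunction F → ∀ α → F (normalForm α) ≡ F α
normalForm-class {n} {F} F-class α = conjugate-class (arrange (byLength n (cycles {FinSet n} α)))
  where
  conjugate-class : ∀ τ → F (conjugate τ α) ≡ F α
  conjugate-class τ = F-class τ λ i → trans (cong (τ ⟨$⟩ʳ_) (Vecₚ.lookup∘tabulate _ i)) (Perm.inverseʳ τ)

extend : Weighted (Permutation′ n) → Weighted (Permutation′ (suc n))
extend {n} t = cartesianProductWith (λ p i → proj₁ p , normalForm (attach (proj₂ p) i)) t (allFin (suc n))

-- Merging at every level, not just at the end, keeps the list as short as the number of partitions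
-- of `n`.
classes : ∀ n → Weighted (Permutation′ n)
classes zero    = (1 , Perm.id) ∷ []
classes (suc n) = foldr (add (permDecSetoid (FinSet (suc n)))) [] (extend (classes n))

weightedSum-extend : ∀ {F : Permutation′ (suc n) → ℕ} → ClassFunction F →
  ∀ t → weightedSum F (extend t) ≡ weightedSum (sum-attach F) t
weightedSum-extend {n} {F} F-class t = trans
  (sum-map-cartesianProductWith (λ p → proj₁ p * F (proj₂ p)) _ t (allFin (suc n)))
  (cong sum (map-cong (λ p → expand (proj₁ p) (proj₂ p)) t))
  where
  expand : ∀ w α → sum (map (λ i → w * F (normalForm (attach α i))) (allFin (suc n))) ≡ w * sum-attach F α
  expand w α = trans (sum-map-* w _ (allFin (suc n)))
    (cong (λ s → w * sum s) (map-cong (λ i → normalForm-class F-class (attach α i)) (allFin (suc n))))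

-- Induction on `n` for all class functions at once: the hypothesis is applied to `sum-attach F`.
-- Merging conjugate terms does not change the sum.
sum-permutations : ∀ n {F : Permutation′ n → ℕ} → ClassFunction F →
                   sum (map F (permutations n)) ≡ weightedSum F (classes n)
sum-permutations zero    {F} F-class = cong (_+ 0) (sym (ℕₚ.+-identityʳ (F Perm.id)))
sum-permutations (suc n) {F} F-class = begin
  sum (map F (permutations (suc n)))                   ≡⟨ permutations-attach n F-class ⟩
  sum (map (sum-attach F) (permutations n))
    ≡⟨ sum-permutations n {sum-attach F} (λ τ {α} {β} → attach-classFunction F-class τ {α} {β}) ⟩
  weightedSum (sum-attach F) (classes n)               ≡⟨ weightedSum-extend F-class (classes n) ⟨
  weightedSum F (extend (classes n))                   ≡⟨ ℕₚ.+-identityʳ _ ⟨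
  weightedSum F (extend (classes n)) + weightedSum F []
    ≡⟨ weightedSum-collect (permDecSetoid (FinSet (suc n))) (λ {α} {β} → ClassFunction-cong F-class {α} {β})
         [] (extend (classes n)) ⟨
  weightedSum F (classes (suc n))                      ∎
  where open ≡-Reasoning

-- Polynomials with natural coefficients

-- Rationals are stored in lowest terms, so the comparison is made between unnormalised fractions.
/1-homo-+ : ∀ m n → + m / 1 ℚ.+ + n / 1 ≡ + (m + n) / 1
/1-homo-+ m n = ℚₚ.toℚᵘ-injective (begin
  toℚᵘ (+ m / 1 ℚ.+ + n / 1)          ≈⟨ ℚₚ.toℚᵘ-homo-+ (+ m / 1) (+ n / 1) ⟩
  toℚᵘ (+ m / 1) ℚᵘ.+ toℚᵘ (+ n / 1)  ≈⟨ ℚᵘₚ.+-cong (ℚₚ.toℚᵘ-fromℚᵘ (whole m)) (ℚₚ.toℚᵘ-fromℚᵘ (whole n)) ⟩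
  whole m ℚᵘ.+ whole n                ≈⟨ ℚᵘ.*≡* (cong (ℤ._* + 1) (cong₂ ℤ._+_ (ℤₚ.*-identityʳ (+ m)) (ℤₚ.*-identityʳ (+ n)))) ⟩
  whole (m + n)                       ≈⟨ ℚₚ.toℚᵘ-fromℚᵘ (whole (m + n)) ⟨
  toℚᵘ (+ (m + n) / 1)                ∎)
  where
  open ℚᵘₚ.≃-Reasoning
  whole = λ m → ℚᵘ.mkℚᵘ (+ m) 0

formal : Weighted Monomial → Polynomial
formal = map (λ t → + proj₁ t / 1 , proj₂ t)

indicator : Monomial → Monomial → ℕ
indicator m m′ = if does (m′ ≈ᵐ? m) then 1 else 0

indicator-cong : ∀ m m₁ m₂ → m₁ ≈ᵐ m₂ → indicator m m₁ ≡ indicator m m₂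
indicator-cong m m₁ m₂ m₁≈m₂ = cong (λ b → if b then 1 else 0) (does-⇔
  (mk⇔ (λ e k → trans (sym (m₁≈m₂ k)) (e k)) (λ e k → trans (m₁≈m₂ k) (e k)))
  (m₁ ≈ᵐ? m) (m₂ ≈ᵐ? m))

-- An arbitrary `b` stands for the comparison of monomials, so the case split is on a variable.
add-term : ∀ q w c {x} b → x ≡ q ℚ.* (+ c / 1) →
           (if b then q ℚ.* (+ w / 1) ℚ.+ x else x) ≡ q ℚ.* (+ (w * (if b then 1 else 0) + c) / 1)
add-term q w c {x} true x≡ = begin
  q ℚ.* (+ w / 1) ℚ.+ x                ≡⟨ cong (λ x → q ℚ.* (+ w / 1) ℚ.+ x) x≡ ⟩
  q ℚ.* (+ w / 1) ℚ.+ q ℚ.* (+ c / 1)  ≡⟨ ℚₚ.*-distribˡ-+ q (+ w / 1) (+ c / 1) ⟨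
  q ℚ.* (+ w / 1 ℚ.+ + c / 1)          ≡⟨ cong (q ℚ.*_) (/1-homo-+ w c) ⟩
  q ℚ.* (+ (w + c) / 1)                ≡⟨ cong (λ n → q ℚ.* (+ (n + c) / 1)) (ℕₚ.*-identityʳ w) ⟨
  q ℚ.* (+ (w * 1 + c) / 1)            ∎
  where open ≡-Reasoning
add-term q w c false x≡ = trans x≡ (cong (λ n → q ℚ.* (+ (n + c) / 1)) (sym (ℕₚ.*-zeroʳ w)))

-- Makes each coefficient a weighted sum of a natural-valued function, the kind of sum that
-- `sum-permutations` evaluates.
coefficient-formal : ∀ q t m → coefficient (q ⊛ formal t) m ≡ q ℚ.* (+ weightedSum (indicator m) t / 1)
coefficient-formal q []             m = sym (ℚₚ.*-zeroʳ q)
coefficient-formal q ((w , m′) ∷ t) m =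
  add-term q w (weightedSum (indicator m) t) (does (m′ ≈ᵐ? m)) (coefficient-formal q t m)

-- Most factors of a `lengthsMonomial` have exponent 0; without them comparisons stay cheap.
prune : Monomial → Monomial
prune = filter (λ t → ¬? (proj₂ t ℕₚ.≟ 0))

prune-≈ : ∀ m → m ≈ᵐ prune m
prune-≈ []                k = refl
prune-≈ ((i , zero) ∷ m)  k with does (i ℕₚ.≟ k)
... | true  = prune-≈ m k
... | false = prune-≈ m k
prune-≈ ((i , suc e) ∷ m) k with does (i ℕₚ.≟ k)
... | true  = cong (λ n → suc e + n) (prune-≈ m k)
... | false = prune-≈ m k

-- The induced permutations of r-subsets

⟨$⟩ˡ-cong : ∀ {α β : Permutation′ p} → α Perm.≈ β → ∀ i → α ⟨$⟩ˡ i ≡ β ⟨$⟩ˡ i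
⟨$⟩ˡ-cong {α = α} {β} eq i =
  trans (cong (α ⟨$⟩ˡ_) (sym (trans (eq _) (Perm.inverseʳ β)))) (Perm.inverseˡ α)

image-cong : ∀ {α β : Permutation′ p} → α Perm.≈ β → ∀ s → image α s ≡ image β s
image-cong {α = α} {β} eq s = Vecₚ.tabulate-cong (λ i → cong (lookup s) (⟨$⟩ˡ-cong {α = α} {β} eq i))

induced-conj : ∀ r {τ α β : Permutation′ p} → Conjugates τ α β →
               ∀ s → rImage r τ (rImage r α s) ≡ rImage r β (rImage r τ s)
induced-conj r {τ} {α} {β} conj s = Refinement.value-injective (begin
  image τ (image α (value s)) ≡⟨ image-∘ τ α (value s) ⟩
  image (τ ↔-∘ α) (value s)   ≡⟨ image-cong {α = τ ↔-∘ α} {β ↔-∘ τ} conj (value s) ⟩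
  image (β ↔-∘ τ) (value s)   ≡⟨ image-∘ β τ (value s) ⟨
  image β (image τ (value s)) ∎)
  where open ≡-Reasoning

inducedMonomial : ∀ {p} r → Permutation′ p → Monomial
inducedMonomial {p} r α = cycleMonomial {RSubsetSet p r} (induced r α)

-- Conjugate permutations of points induce conjugate permutations of `r`-subsets, by the induced
-- conjugator.
inducedMonomial-class : ∀ r m → ClassFunction (λ (α : Permutation′ p) → indicator m (inducedMonomial r α))
inducedMonomial-class {p} r m τ {α} {β} conj = cong (indicator m)
  (sym (cycleMonomial-conj {RSubsetSet p r} {induced r α} {induced r β} (induced r τ)
    (induced-conj r {τ} {α} {β} conj)))

-- Holds iff 0 < r < p or p ≤ 1.
Separating : ℕ → ℕ → Set
Separating p r = ∀ (i k : Fin p) → i ≢ k → Any (λ s → lookup (value s) i ≢ lookup (value s) k) (rSubsets p r)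

separating? : ∀ p r → Dec (Separating p r)
separating? p r = allᶠ? λ i → allᶠ? λ k →
  ¬? (i ≟ᶠ k) →-dec Any.any? (λ s → ¬? (lookup (value s) i ≟ᵇ lookup (value s) k)) (rSubsets p r)

-- If the preimages of `i` under `α` and `β` differed, some `r`-subset would contain exactly one of
-- them, and its two images would differ at `i`.
induced-injective : Separating p r → ∀ {α β : Permutation′ p} →
                    (∀ s → rImage r α s ≡ rImage r β s) → α Perm.≈ β
induced-injective {p} {r} separating {α} {β} eq = ⟨$⟩ˡ-cong {α = Perm.flip α} {Perm.flip β} from≗
  where
  lookup-≡ : ∀ i s → lookup (value s) (α ⟨$⟩ˡ i) ≡ lookup (value s) (β ⟨$⟩ˡ i)
  lookup-≡ i s = trans (sym (Vecₚ.lookup∘tabulate _ i))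
    (trans (cong (λ s → lookup (value s) i) (eq s)) (Vecₚ.lookup∘tabulate _ i))

  from≗ : ∀ i → α ⟨$⟩ˡ i ≡ β ⟨$⟩ˡ i
  from≗ i = decidable-stable (_ ≟ᶠ _) λ ≢ →
    let s , s≢ = Any.satisfied (separating _ _ ≢) in s≢ (lookup-≡ i s)

-- The cycle index as a formal sum over all permutations of the points

deduplicate-id : ∀ {R : Rel A ℓ} (R? : Decidable₂ R) {xs} →
                 AllPairs (λ x y → ¬ R x y) xs → deduplicate R? xs ≡ xs
deduplicate-id R? []             = refl
deduplicate-id R? {x ∷ _} (x∉ ∷ xs!) = cong (x ∷_)
  (trans (cong (filter (¬? ∘ R? x)) (deduplicate-id R? xs!)) (filter-all (¬? ∘ R? x) x∉))

length-cartesianProductWith : ∀ (f : A → B → C) xs ys →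
  length (cartesianProductWith f xs ys) ≡ length xs * length ys
length-cartesianProductWith f []       ys = refl
length-cartesianProductWith f (x ∷ xs) ys = trans (length-++ (map (f x) ys))
  (cong₂ _+_ (length-map (f x) ys) (length-cartesianProductWith f xs ys))

length-permutations : ∀ p → length (permutations p) ≡ p !
length-permutations zero    = refl
length-permutations (suc p) = trans
  (length-cartesianProductWith (Perm.insert zero) (allFin (suc p)) (permutations p))
  (cong₂ _*_ (length-tabulate {n = suc p} (λ i → i)) (length-permutations p))

-- The order occurs in a denominator together with a proof that it is nonzero; with variables `xs`
-- and `n` both equations can be matched directly.
Z-elements : ∀ {X : FiniteSet} (G : PermutationGroup X) {xs n} .{{_ : NonZero n}} →
             PermutationGroup.elements G ≡ xs → length xs ≡ n →
             Z G ≡ (+ 1 / n) ⊛ map (λ α → 1ℚ , cycleMonomial {X} α) xs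
Z-elements G refl refl = refl

-- Separation makes the induced permutations distinct, so deduplication removes nothing and the
-- group has order `p !`.
Z-induced : .{{_ : NonZero (p !)}} → Separating p r → Z (S⟨ p ⟩^ r) ≡
  (+ 1 / (p !)) ⊛ formal (map (λ α → 1 , inducedMonomial r α) (permutations p))
Z-induced {p} {r} separating = trans
  (Z-elements (S⟨ p ⟩^ r)
    (deduplicate-id (DecSetoid._≟_ (permDecSetoid (RSubsetSet p r)))
      (UniqueSₚ.map⁺ (permSetoid (FinSet p)) (permSetoid (RSubsetSet p r))
        (λ {α} {β} → induced-injective separating {α} {β}) (permutations-unique p)))
    (trans (length-map (induced r) (permutations p)) (length-permutations p)))
  (cong ((+ 1 / (p !)) ⊛_) (trans (sym (map-∘ (permutations p))) (map-∘ (permutations p))))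

-- Evaluation

monomialDecSetoid : DecSetoid 0ℓ 0ℓ
monomialDecSetoid = record
  { Carrier = Monomial
  ; _≈_ = _≈ᵐ_
  ; isDecEquivalence = record
    { isEquivalence = record
      { refl  = λ _ → refl
      ; sym   = λ e k → sym (e k)
      ; trans = λ e e′ k → trans (e k) (e′ k)
      }
    ; _≟_ = _≈ᵐ?_
    }
  }

evaluatedMonomial : ∀ {p} r → Permutation′ p → Monomial
evaluatedMonomial {p} r α =
  prune (lengthsMonomial (length (rSubsets p r)) (cycleLengths {RSubsetSet p r} (induced r α)))

evaluatedMonomial-≈ : ∀ {p} r (α : Permutation′ p) → inducedMonomial r α ≈ᵐ evaluatedMonomial r α
evaluatedMonomial-≈ {p} r α k = trans (cong (exponent k) (cycleMonomial-lengths {RSubsetSet p r} (induced r α)))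
  (prune-≈ (lengthsMonomial (length (rSubsets p r)) (cycleLengths {RSubsetSet p r} (induced r α))) k)

zeroWeights : Weighted A → Weighted A
zeroWeights = map (λ t → 0 , proj₂ t)

weightedSum-zeroWeights : ∀ (F : A → ℕ) t → weightedSum F (zeroWeights t) ≡ 0
weightedSum-zeroWeights F []      = refl
weightedSum-zeroWeights F (_ ∷ t) = weightedSum-zeroWeights F t

-- The classes of S_p collected on the monomials of t, in the order of t.
expansion : (p r : ℕ) → Weighted Monomial → Weighted Monomial
expansion p r t = foldr (add monomialDecSetoid) (zeroWeights t)
  (map (λ c → proj₁ c , evaluatedMonomial r (proj₂ c)) (classes p))

_≟ʷ_ : DecidableEquality (Weighted Monomial)
_≟ʷ_ = ≡-dec (Productₚ.≡-dec ℕₚ._≟_ (≡-dec (Productₚ.≡-dec ℕₚ._≟_ ℕₚ._≟_)))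

-- Connects the computed list with the sum over all permutations: collecting preserves sums, the
-- zero weights add nothing, and `sum-permutations` replaces classes by permutations.
weightedSum-expansion : ∀ p r t m → weightedSum (indicator m) (expansion p r t) ≡
  weightedSum (indicator m) (map (λ α → 1 , inducedMonomial r α) (permutations p))
weightedSum-expansion p r t m = begin
  weightedSum χ (expansion p r t)
    ≡⟨ weightedSum-collect monomialDecSetoid (λ {x} {y} → indicator-cong m x y) (zeroWeights t) evaluated ⟩
  weightedSum χ evaluated + weightedSum χ (zeroWeights t)
    ≡⟨ cong (λ z → weightedSum χ evaluated + z) (weightedSum-zeroWeights χ t) ⟩
  weightedSum χ evaluated + 0
    ≡⟨ ℕₚ.+-identityʳ _ ⟩
  weightedSum χ evaluated
    ≡⟨ cong sum (map-∘ (classes p)) ⟨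
  sum (map (λ c → proj₁ c * χ (evaluatedMonomial r (proj₂ c))) (classes p))
    ≡⟨ cong sum (map-cong (λ c → cong (proj₁ c *_) (indicator-evaluated (proj₂ c))) (classes p)) ⟨
  weightedSum (χ ∘ inducedMonomial r) (classes p)
    ≡⟨ sum-permutations p (λ τ {α} {β} → inducedMonomial-class r m τ {α} {β}) ⟨
  sum (map (χ ∘ inducedMonomial r) (permutations p))
    ≡⟨ cong sum (map-cong (λ α → ℕₚ.*-identityˡ (χ (inducedMonomial r α))) (permutations p)) ⟨
  sum (map (λ α → 1 * χ (inducedMonomial r α)) (permutations p))
    ≡⟨ cong sum (map-∘ (permutations p)) ⟩
  weightedSum χ (map (λ α → 1 , inducedMonomial r α) (permutations p)) ∎
  where
  open ≡-Reasoning
  χ = indicator m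
  evaluated = map (λ c → proj₁ c , evaluatedMonomial r (proj₂ c)) (classes p)

  indicator-evaluated : ∀ α → χ (inducedMonomial r α) ≡ χ (evaluatedMonomial r α)
  indicator-evaluated α =
    indicator-cong m (inducedMonomial r α) (evaluatedMonomial r α) (evaluatedMonomial-≈ r α)

-- Inverse to formal on polynomials with natural coefficients.
weights : Polynomial → Weighted Monomial
weights = map (λ t → ℤ.∣ ℚ.ℚ.numerator (proj₁ t) ∣ , proj₂ t)

-- Reduces the cycle index to a decidable equality of lists of natural weights. The hypothesis
-- `integral` says that `f` has natural coefficients.
Z-expansion : ∀ p r .{{_ : NonZero (p !)}} → Separating p r →
              ∀ f → formal (weights f) ≡ f → expansion p r (weights f) ≡ weights f →
              Z (S⟨ p ⟩^ r) ≈ᵖ (+ 1 / (p !)) ⊛ f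
Z-expansion p r separating f integral eq m = begin
  coefficient (Z (S⟨ p ⟩^ r)) m                      ≡⟨ cong (λ f → coefficient f m) (Z-induced separating) ⟩
  coefficient (q ⊛ formal all) m                     ≡⟨ coefficient-formal q all m ⟩
  q ℚ.* (+ weightedSum (indicator m) all / 1)        ≡⟨ cong (λ n → q ℚ.* (+ n / 1)) same-count ⟩
  q ℚ.* (+ weightedSum (indicator m) (weights f) / 1) ≡⟨ coefficient-formal q (weights f) m ⟨
  coefficient (q ⊛ formal (weights f)) m             ≡⟨ cong (λ f → coefficient (q ⊛ f) m) integral ⟩
  coefficient (q ⊛ f) m                              ∎
  where
  open ≡-Reasoning
  q = + 1 / (p !)
  all = map (λ α → 1 , inducedMonomial r α) (permutations p)

  same-count : weightedSum (indicator m) all ≡ weightedSum (indicator m) (weights f)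
  same-count = trans (sym (weightedSum-expansion p r (weights f) m)) (cong (weightedSum (indicator m)) eq)

-- Unifying the theorem's right-hand side with a formal sum would unfold both
-- branches of every coefficient test, so it is passed to Z-expansion by name.
classSum : Polynomial
classSum =
    ( 1 ∙ a[ 1 ]^ 126
    ⊕ 36 ∙ a[ 1 ]^ 56 · a[ 2 ]^ 35
    ⊕ 378 ∙ a[ 1 ]^ 26 · a[ 2 ]^ 50
    ⊕ 168 ∙ a[ 1 ]^ 21 · a[ 3 ]^ 35
    ⊕ 1260 ∙ a[ 1 ]^ 12 · a[ 2 ]^ 57
    ⊕ 2520 ∙ a[ 1 ]^ 11 · a[ 2 ]^ 5 · a[ 3 ]^ 15 · a[ 6 ]^ 10
    ⊕ 945 ∙ a[ 1 ]^ 6 · a[ 2 ]^ 60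
    ⊕ 756 ∙ a[ 1 ]^ 6 · a[ 2 ]^ 10 · a[ 4 ]^ 25
    ⊕ 3360 ∙ a[ 1 ]^ 6 · a[ 3 ]^ 40
    ⊕ 7560 ∙ a[ 1 ]^ 5 · a[ 2 ]^ 8 · a[ 3 ]^ 7 · a[ 6 ]^ 14
    ⊕ 7560 ∙ a[ 1 ]^ 4 · a[ 2 ]^ 11 · a[ 4 ]^ 25
    ⊕ 15120 ∙ a[ 1 ]^ 3 · a[ 2 ]^ 1 · a[ 3 ]^ 1 · a[ 4 ]^ 4 · a[ 6 ]^ 3 · a[ 12 ]^ 7
    ⊕ 2520 ∙ a[ 1 ]^ 3 · a[ 2 ]^ 9 · a[ 3 ]^ 3 · a[ 6 ]^ 16
    ⊕ 11340 ∙ a[ 1 ]^ 2 · a[ 2 ]^ 12 · a[ 4 ]^ 25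
    ⊕ 10080 ∙ a[ 1 ]^ 2 · a[ 2 ]^ 2 · a[ 3 ]^ 18 · a[ 6 ]^ 11
    ⊕ 11340 ∙ a[ 1 ]^ 2 · a[ 2 ]^ 2 · a[ 4 ]^ 30
    ⊕ 9072 ∙ a[ 1 ]^ 1 · a[ 5 ]^ 5 · a[ 10 ]^ 10
    ⊕ 18144 ∙ a[ 1 ]^ 1 · a[ 5 ]^ 11 · a[ 10 ]^ 7
    ⊕ 18144 ∙ a[ 1 ]^ 1 · a[ 5 ]^ 1 · a[ 10 ]^ 2 · a[ 20 ]^ 5
    ⊕ 15120 ∙ a[ 1 ]^ 1 · a[ 2 ]^ 2 · a[ 3 ]^ 1 · a[ 4 ]^ 4 · a[ 6 ]^ 3 · a[ 12 ]^ 7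
    ⊕ 24192 ∙ a[ 1 ]^ 1 · a[ 5 ]^ 4 · a[ 15 ]^ 7
    ⊕ 3024 ∙ a[ 1 ]^ 1 · a[ 5 ]^ 25
    ⊕ 25920 ∙ a[ 7 ]^ 8 · a[ 14 ]^ 5
    ⊕ 10080 ∙ a[ 2 ]^ 3 · a[ 3 ]^ 4 · a[ 6 ]^ 18
    ⊕ 30240 ∙ a[ 2 ]^ 3 · a[ 3 ]^ 2 · a[ 6 ]^ 19
    ⊕ 45360 ∙ a[ 2 ]^ 1 · a[ 4 ]^ 1 · a[ 8 ]^ 15
    ⊕ 2240 ∙ a[ 3 ]^ 42
    ⊕ 20160 ∙ a[ 3 ]^ 4 · a[ 6 ]^ 19
    ⊕ 25920 ∙ a[ 7 ]^ 18
    ⊕ 40320 ∙ a[ 9 ]^ 14 )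

separating-9-4 : Separating 9 4
separating-9-4 = toWitness {a? = separating? 9 4} _

mainTheorem7 : Z (S⟨ 9 ⟩^ 4) ≈ᵖ
    (+ 1 / (9 !)) ⊛
    ( 1 ∙ a[ 1 ]^ 126
    ⊕ 36 ∙ a[ 1 ]^ 56 · a[ 2 ]^ 35
    ⊕ 378 ∙ a[ 1 ]^ 26 · a[ 2 ]^ 50
    ⊕ 168 ∙ a[ 1 ]^ 21 · a[ 3 ]^ 35
    ⊕ 1260 ∙ a[ 1 ]^ 12 · a[ 2 ]^ 57
    ⊕ 2520 ∙ a[ 1 ]^ 11 · a[ 2 ]^ 5 · a[ 3 ]^ 15 · a[ 6 ]^ 10
    ⊕ 945 ∙ a[ 1 ]^ 6 · a[ 2 ]^ 60
    ⊕ 756 ∙ a[ 1 ]^ 6 · a[ 2 ]^ 10 · a[ 4 ]^ 25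
    ⊕ 3360 ∙ a[ 1 ]^ 6 · a[ 3 ]^ 40
    ⊕ 7560 ∙ a[ 1 ]^ 5 · a[ 2 ]^ 8 · a[ 3 ]^ 7 · a[ 6 ]^ 14
    ⊕ 7560 ∙ a[ 1 ]^ 4 · a[ 2 ]^ 11 · a[ 4 ]^ 25
    ⊕ 15120 ∙ a[ 1 ]^ 3 · a[ 2 ]^ 1 · a[ 3 ]^ 1 · a[ 4 ]^ 4 · a[ 6 ]^ 3 · a[ 12 ]^ 7
    ⊕ 2520 ∙ a[ 1 ]^ 3 · a[ 2 ]^ 9 · a[ 3 ]^ 3 · a[ 6 ]^ 16
    ⊕ 11340 ∙ a[ 1 ]^ 2 · a[ 2 ]^ 12 · a[ 4 ]^ 25
    ⊕ 10080 ∙ a[ 1 ]^ 2 · a[ 2 ]^ 2 · a[ 3 ]^ 18 · a[ 6 ]^ 11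
    ⊕ 11340 ∙ a[ 1 ]^ 2 · a[ 2 ]^ 2 · a[ 4 ]^ 30
    ⊕ 9072 ∙ a[ 1 ]^ 1 · a[ 5 ]^ 5 · a[ 10 ]^ 10
    ⊕ 18144 ∙ a[ 1 ]^ 1 · a[ 5 ]^ 11 · a[ 10 ]^ 7
    ⊕ 18144 ∙ a[ 1 ]^ 1 · a[ 5 ]^ 1 · a[ 10 ]^ 2 · a[ 20 ]^ 5
    ⊕ 15120 ∙ a[ 1 ]^ 1 · a[ 2 ]^ 2 · a[ 3 ]^ 1 · a[ 4 ]^ 4 · a[ 6 ]^ 3 · a[ 12 ]^ 7
    ⊕ 24192 ∙ a[ 1 ]^ 1 · a[ 5 ]^ 4 · a[ 15 ]^ 7
    ⊕ 3024 ∙ a[ 1 ]^ 1 · a[ 5 ]^ 25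
    ⊕ 25920 ∙ a[ 7 ]^ 8 · a[ 14 ]^ 5
    ⊕ 10080 ∙ a[ 2 ]^ 3 · a[ 3 ]^ 4 · a[ 6 ]^ 18
    ⊕ 30240 ∙ a[ 2 ]^ 3 · a[ 3 ]^ 2 · a[ 6 ]^ 19
    ⊕ 45360 ∙ a[ 2 ]^ 1 · a[ 4 ]^ 1 · a[ 8 ]^ 15
    ⊕ 2240 ∙ a[ 3 ]^ 42
    ⊕ 20160 ∙ a[ 3 ]^ 4 · a[ 6 ]^ 19
    ⊕ 25920 ∙ a[ 7 ]^ 18
    ⊕ 40320 ∙ a[ 9 ]^ 14 )
-- `refl` checks that the coefficients are natural numbers; `toWitness` evaluates the monomials of
-- the 30 class representatives and compares the collected weights.
mainTheorem7 = Z-expansion 9 4 separating-9-4 classSum refl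
  (toWitness {a? = expansion 9 4 (weights classSum) ≟ʷ weights classSum} _)
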